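{- Let $X$ be a locally compact Polish space, let $\boldsymbol{\mathcal U}=((X_n),(\mathcal U_\alpha),(r^\beta_\alpha))$ be a covering system for $X$, and let $K$ be a countable locally finite simplicial complex with vertex set $\mathrm{dom}(K)=\mathbb N$. Then there is a Borel map $f\mapsto(\alpha_f,p_f)$ from the Polish space $\mathrm{Map}(X,|K|)$ of continuous maps $X\to|K|$ (compact-open topology) to the Polish space $\mathrm{SA}_{\boldsymbol{\mathcal U}}(X,K)$ such that $$f(x)\in\mathrm{St}_K(p_f(U))\quad\text{for all } x\in U\in\mathcal U_{\alpha_f}.$$
   Context: $|K|$ is the topological realization; the open star $\mathrm{St}_K(v)\subseteq|K|$ of a vertex $v$ is the set of points whose barycentric coordinate at $v$ is positive. $\mathcal N^*$ is the set of non-decreasing functions $\mathbb N\to\mathbb N$ (subspace of Baire space), ordered pointwise; $\alpha|n=(\alpha(0),\dots,\alpha(n-1))$; $\mathcal N^*_s=\{\alpha\in\mathcal N^*:\alpha|n=s\}$ for $s$ of length $n$. For a family $\mathcal U$ of open sets and $C\subseteq X$, $\mathcal U\upharpoonright C=\{U\in\mathcal U:U\cap C\neq\emptyset\}$. Write $\mathcal U\preceq\mathcal V$ if there is a refinement map $r:\mathcal V\to\mathcal U$, i.e. $V\subseteq r(V)$ for all $V\in\mathcal V$. A covering system for $X$ is a triple $((X_n),(\mathcal U_\alpha),(r^\beta_\alpha))$ where $\emptyset=X_0\subseteq X_1\subseteq\cdots$ are compact with union $X$; $(\mathcal U_\alpha)_{\alpha\in\mathcal N^*}$ are locally finite open covers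 of $X$; $r^\beta_\alpha:\mathcal U_\beta\to\mathcal U_\alpha$ ($\alpha\le\beta$) are refinement maps with $r^\alpha_\alpha=\mathrm{id}$ and $r^\gamma_\alpha=r^\beta_\alpha\circ r^\gamma_\beta$; and for all $n$: (L1) if $\alpha|n=\beta|n$ then $\mathcal U_\alpha\upharpoonright X_n=\mathcal U_\beta\upharpoonright X_n$; (L2) if $\alpha\le\beta$, $\gamma\le\delta$, $\alpha|n=\gamma|n$, $\beta|n=\delta|n$ then $r^\beta_\alpha$ and $r^\delta_\gamma$ agree on $\mathcal U_\beta\upharpoonright X_n$; (L3) if $\alpha\le\beta$ then $r^\beta_\alpha$ maps $\mathcal U_\beta\upharpoonright X_n$ onto $\mathcal U_\alpha\upharpoonright X_n$; (E1) for every open cover $\mathcal U$ of $X$ and $m>n$, if $\mathcal U\upharpoonright X_n\preceq\mathcal U_\alpha\upharpoonright X_n$ then there is $\beta\in\mathcal N^*_{\alpha|n}$ with $\mathcal U\upharpoonright X_m\preceq\mathcal U_\beta\upharpoonright X_m$. Put $S=\bigcup_{\alpha}\mathcal U_\alpha$ (a countable set, assumed not to contain $\emptyset$) and let $N_\alpha$ be the nerve of $\mathcal U_\alpha$ (finite subsets of $\mathcal U_\alpha$ with nonempty intersection). $\mathrm{SA}_{\boldsymbol{\mathcal U}}(X,K)\subseteq\mathcal N^*\times\mathrm{dom}(K)^S$ (product topology, $\mathrm{dom}(K)$ discrete) is the closed set of pairs $(\alpha,p)$ such that $p|_{\mathcal U_\alpha}$ is a simplicial map $N_\alpha\to K$ and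 $p(U)=0$ for $U\notin\mathcal U_\alpha$. -}

module Defs where

open import Level using (Level; 0ℓ; _⊔_) renaming (suc to lsuc)
open import Data.Unit.Base using (⊤; tt)
open import Data.Nat.Base as ℕ using (ℕ; suc)
import Data.Nat.Properties as ℕₚ
open import Data.Rational.Base as ℚ using (ℚ; 0ℚ; 1ℚ; ½; ∣_∣)
import Data.Rational.Properties as ℚₚ
open import Data.Rational.Solver using (module +-*-Solver)
open import Data.List.Base using (List; []; _∷_; _++_; map; foldr)
open import Data.List.Membership.Propositional using () renaming (_∈_ to _∈ᴸ_)
open import Data.List.Relation.Binary.Subset.Propositional using () renaming (_⊆_ to _⊆ᴸ_)
open import Data.List.Relation.Unary.All using (All; []; _∷_)
import Data.List.Relation.Unary.All.Properties as Allₚ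
open import Data.List.Relation.Unary.Any using (Any)
open import Data.List.Relation.Unary.Unique.Propositional using (Unique)
open import Data.Maybe.Base using (Maybe; just)
open import Data.Product.Base using (Σ-syntax; ∃-syntax; _×_; _,_; proj₁; proj₂; swap)
open import Data.Sum.Base using (inj₁; inj₂)
open import Function.Base using (_∘_)
open import Function.Bundles using (Func; _⇔_)
open import Relation.Binary.Bundles using (Setoid)
open import Relation.Binary.Definitions using (_Respects_)
import Relation.Binary.Construct.On as On
open import Relation.Binary.PropositionalEquality as ≡ using (_≡_; _≢_; _≗_)
open import Relation.Unary using (Pred; _∈_; _∉_; _⊆_; _≐_; _∩_; ∁; _≬_; _⊢_; ⋃; Empty; Satisfiable)
open import Relation.Unary.Relation.Binary.Equality using (≐-setoid)

private
  variable
    a b c ℓ ℓ′ c′ o o′ : Level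

-- Cauchy sequences of rationals, compared as their limits.
record ℝ : Set where
  no-eta-equality
  field
    seq    : ℕ → ℚ
    cauchy : ∀ {ε} → 0ℚ ℚ.< ε →
             ∃[ N ] ∀ {m n} → N ℕ.≤ m → N ℕ.≤ n → ∣ seq m ℚ.- seq n ∣ ℚ.< ε
open ℝ

infix  4 _≤ᴿ_ _<ᴿ_ _≈ᴿ_
infixl 6 _+ᴿ_

record _≤ᴿ_ (x y : ℝ) : Set where
  constructor *≤*
  field
    approx : ∀ {ε} → 0ℚ ℚ.< ε → ∃[ N ] ∀ {n} → N ℕ.≤ n → seq x n ℚ.≤ seq y n ℚ.+ ε
open _≤ᴿ_

record _<ᴿ_ (x y : ℝ) : Set where
  constructor *<*
  field
    {gap}     : ℚ
    gap>0     : 0ℚ ℚ.< gap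
    separated : ∃[ N ] ∀ {n} → N ℕ.≤ n → seq x n ℚ.+ gap ℚ.≤ seq y n

_≈ᴿ_ : ℝ → ℝ → Set
x ≈ᴿ y = x ≤ᴿ y × y ≤ᴿ x

private
  half>0 : ∀ {ε} → 0ℚ ℚ.< ε → 0ℚ ℚ.< ½ ℚ.* ε
  half>0 {ε} ε>0 =
    ≡.subst (ℚ._< ½ ℚ.* ε) (ℚₚ.*-zeroʳ ½) (ℚₚ.*-monoʳ-<-pos ½ ε>0)

  halves : ∀ ε → ½ ℚ.* ε ℚ.+ ½ ℚ.* ε ≡ ε
  halves ε = ≡.trans (≡.sym (ℚₚ.*-distribʳ-+ ε ½ ½)) (ℚₚ.*-identityˡ ε)

  rearrange : ∀ p q r s → (p ℚ.+ q) ℚ.- (r ℚ.+ s) ≡ (p ℚ.- r) ℚ.+ (q ℚ.- s)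
  rearrange = solve 4 (λ p q r s → (p :+ q) :- (r :+ s) := (p :- r) :+ (q :- s)) ≡.refl
    where open +-*-Solver

fromℚ : ℚ → ℝ
fromℚ q .seq _ = q
fromℚ q .cauchy {ε} ε>0 =
  0 , λ _ _ → ≡.subst (λ r → ∣ r ∣ ℚ.< ε) (≡.sym (ℚₚ.+-inverseʳ q)) ε>0

0ᴿ 1ᴿ : ℝ
0ᴿ = fromℚ 0ℚ
1ᴿ = fromℚ 1ℚ

_+ᴿ_ : ℝ → ℝ → ℝ
(x +ᴿ y) .seq n = seq x n ℚ.+ seq y n
(x +ᴿ y) .cauchy {ε} ε>0 with cauchy x (half>0 ε>0) | cauchy y (half>0 ε>0)
... | M , p | N , q = M ℕ.⊔ N , λ {m} {n} m≥ n≥ → begin-strict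
  ∣ (seq x m ℚ.+ seq y m) ℚ.- (seq x n ℚ.+ seq y n) ∣
    ≡⟨ ≡.cong ∣_∣ (rearrange (seq x m) (seq y m) (seq x n) (seq y n)) ⟩
  ∣ (seq x m ℚ.- seq x n) ℚ.+ (seq y m ℚ.- seq y n) ∣
    ≤⟨ ℚₚ.∣p+q∣≤∣p∣+∣q∣ (seq x m ℚ.- seq x n) (seq y m ℚ.- seq y n) ⟩
  ∣ seq x m ℚ.- seq x n ∣ ℚ.+ ∣ seq y m ℚ.- seq y n ∣
    <⟨ ℚₚ.+-mono-< (p (ℕₚ.m⊔n≤o⇒m≤o M N m≥) (ℕₚ.m⊔n≤o⇒m≤o M N n≥))
                   (q (ℕₚ.m⊔n≤o⇒n≤o M N m≥) (ℕₚ.m⊔n≤o⇒n≤o M N n≥)) ⟩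
  ½ ℚ.* ε ℚ.+ ½ ℚ.* ε
    ≡⟨ halves ε ⟩
  ε ∎
  where open ℚₚ.≤-Reasoning

≤ᴿ-refl : ∀ {x} → x ≤ᴿ x
≤ᴿ-refl {x} .approx ε>0 =
  0 , λ {n} _ → ℚₚ.≤-trans (ℚₚ.≤-reflexive (≡.sym (ℚₚ.+-identityʳ (seq x n))))
                            (ℚₚ.+-monoʳ-≤ (seq x n) (ℚₚ.<⇒≤ ε>0))

≤ᴿ-trans : ∀ {x y z} → x ≤ᴿ y → y ≤ᴿ z → x ≤ᴿ z
≤ᴿ-trans {x} {y} {z} x≤y y≤z .approx {ε} ε>0 with approx x≤y (half>0 ε>0) | approx y≤z (half>0 ε>0)
... | M , p | N , q = M ℕ.⊔ N , λ {n} n≥ → begin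
  seq x n                                 ≤⟨ p (ℕₚ.m⊔n≤o⇒m≤o M N n≥) ⟩
  seq y n ℚ.+ ½ ℚ.* ε                     ≤⟨ ℚₚ.+-monoˡ-≤ (½ ℚ.* ε) (q (ℕₚ.m⊔n≤o⇒n≤o M N n≥)) ⟩
  (seq z n ℚ.+ ½ ℚ.* ε) ℚ.+ ½ ℚ.* ε       ≡⟨ ℚₚ.+-assoc (seq z n) (½ ℚ.* ε) (½ ℚ.* ε) ⟩
  seq z n ℚ.+ (½ ℚ.* ε ℚ.+ ½ ℚ.* ε)       ≡⟨ ≡.cong (seq z n ℚ.+_) (halves ε) ⟩
  seq z n ℚ.+ ε ∎
  where open ℚₚ.≤-Reasoning

-- | x - y | < r
_within_of_ : ℝ → ℝ → ℝ → Set
x within r of y = x <ᴿ y +ᴿ r × y <ᴿ x +ᴿ r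

private
  <-widen : ∀ {x y δ ε} → δ ℚ.≤ ε → x <ᴿ y +ᴿ fromℚ δ → x <ᴿ y +ᴿ fromℚ ε
  <-widen {y = y} δ≤ε (*<* η>0 (N , p)) =
    *<* η>0 (N , λ {n} n≥ → ℚₚ.≤-trans (p n≥) (ℚₚ.+-monoʳ-≤ (seq y n) δ≤ε))

  within-widen : ∀ {x y δ ε} → δ ℚ.≤ ε → x within fromℚ δ of y → x within fromℚ ε of y
  within-widen {x} {y} δ≤ε (p , q) = <-widen {x} {y} δ≤ε p , <-widen {y} {x} δ≤ε q

  ⊓>0 : ∀ {δ ε} → 0ℚ ℚ.< δ → 0ℚ ℚ.< ε → 0ℚ ℚ.< δ ℚ.⊓ ε
  ⊓>0 {δ} {ε} δ>0 ε>0 with ℚₚ.⊓-sel δ ε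
  ... | inj₁ eq = ≡.subst (0ℚ ℚ.<_) (≡.sym eq) δ>0
  ... | inj₂ eq = ≡.subst (0ℚ ℚ.<_) (≡.sym eq) ε>0

-- Points form a setoid, so that reals, continuous maps and the like need no
-- quotients.  Subsets are predicates in Set; in the presence of excluded middle
-- this is no restriction, as every type is then logically equivalent to ⊤ or ⊥.
record Space (c ℓ o : Level) : Set (lsuc (c ⊔ ℓ ⊔ o) ⊔ lsuc 0ℓ) where
  field
    setoid : Setoid c ℓ
  open Setoid setoid public using (Carrier; _≈_)
  field
    Open      : Pred Carrier 0ℓ → Set o
    open-resp : ∀ {W} → Open W → W Respects _≈_
    open-full : Open (λ _ → ⊤)
    open-∩    : ∀ {V W} → Open V → Open W → Open (V ∩ W)
    -- Closure under arbitrary unions, phrased locally so as not to bound the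
    -- universe of the index type.
    open-⋃    : ∀ {W} → (∀ {x} → x ∈ W → ∃[ V ] Open V × x ∈ V × V ⊆ W) → Open W

generated : (A : Setoid c ℓ) (let open Setoid A using (Carrier; _≈_))
            (𝓑 : Pred (Pred Carrier 0ℓ) o) → (∀ {B} → B ∈ 𝓑 → B Respects _≈_) →
            Space c ℓ (c ⊔ o ⊔ lsuc 0ℓ)
generated {c = c} {o = o} A 𝓑 𝓑-resp = record
  { setoid    = A
  ; Open      = Open
  ; open-resp = λ W-open x≈y x∈W → let _ , Bs∈𝓑 , x∈Bs , Bs⊆W = W-open x∈W in
                                    Bs⊆W (All-resp Bs∈𝓑 x≈y x∈Bs)
  ; open-full = λ _ → [] , [] , [] , _
  ; open-∩    = λ V-open W-open (x∈V , x∈W) →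
                  let Bs , Bs∈𝓑 , x∈Bs , Bs⊆V = V-open x∈V
                      Cs , Cs∈𝓑 , x∈Cs , Cs⊆W = W-open x∈W
                  in Bs ++ Cs , Allₚ.++⁺ Bs∈𝓑 Cs∈𝓑 , Allₚ.++⁺ x∈Bs x∈Cs ,
                     λ y∈ → Bs⊆V (Allₚ.++⁻ˡ Bs y∈) , Cs⊆W (Allₚ.++⁻ʳ Bs y∈)
  ; open-⋃    = λ nbhd x∈W → let _ , V-open , x∈V , V⊆W = nbhd x∈W
                                 Bs , Bs∈𝓑 , x∈Bs , Bs⊆V = V-open x∈V
                             in Bs , Bs∈𝓑 , x∈Bs , λ y∈ → V⊆W (Bs⊆V y∈)
  }
  where
  open Setoid A using (Carrier; _≈_)

  Open : Pred Carrier 0ℓ → Set (c ⊔ o ⊔ lsuc 0ℓ)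
  Open W = ∀ {x} → x ∈ W →
    Σ[ Bs ∈ List (Pred Carrier 0ℓ) ]
      All (_∈ 𝓑) Bs × All (x ∈_) Bs × (∀ {y} → All (y ∈_) Bs → y ∈ W)

  All-resp : ∀ {Bs x y} → All (_∈ 𝓑) Bs → x ≈ y → All (x ∈_) Bs → All (y ∈_) Bs
  All-resp []        x≈y []         = []
  All-resp (b ∷ bs) x≈y (x∈ ∷ xs∈) = 𝓑-resp b x≈y x∈ ∷ All-resp bs x≈y xs∈

module _ (X : Space c ℓ o) where
  open Space X

  Compact : Pred Carrier 0ℓ → Set (c ⊔ o ⊔ lsuc 0ℓ)
  Compact C = (𝓦 : Pred (Pred Carrier 0ℓ) 0ℓ) → 𝓦 ⊆ Open →
    (∀ {x} → x ∈ C → ∃[ W ] W ∈ 𝓦 × x ∈ W) →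
    Σ[ Ws ∈ List (Pred Carrier 0ℓ) ]
      All (_∈ 𝓦) Ws × (∀ {x} → x ∈ C → Any (x ∈_) Ws)

  LocallyCompact : Set (c ⊔ o ⊔ lsuc 0ℓ)
  LocallyCompact = ∀ x → ∃[ V ] ∃[ C ] Open V × x ∈ V × V ⊆ C × Compact C

  data Borel : Pred Carrier 0ℓ → Set (c ⊔ o ⊔ lsuc 0ℓ) where
    open-set   : ∀ {W} → Open W → Borel W
    complement : ∀ {B} → Borel B → Borel (∁ B)
    ⋃-ℕ        : ∀ {B : ℕ → Pred Carrier 0ℓ} → (∀ n → Borel (B n)) → Borel (⋃ ℕ B)
    resp-≐     : ∀ {B B′} → B ≐ B′ → Borel B → Borel B′

  record IsMetric (d : Carrier → Carrier → ℝ) : Set (c ⊔ ℓ) where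
    field
      zero-dist : ∀ {x y} → x ≈ y ⇔ d x y ≈ᴿ 0ᴿ
      nonneg    : ∀ x y → 0ᴿ ≤ᴿ d x y
      symmetric : ∀ x y → d x y ≈ᴿ d y x
      triangle  : ∀ x y z → d x z ≤ᴿ d x y +ᴿ d y z

  -- Here and below radii are positive rationals: every positive real exceeds one.
  Induces : (Carrier → Carrier → ℝ) → Set (c ⊔ o ⊔ lsuc 0ℓ)
  Induces d = ∀ {W} → Open W ⇔
    (∀ {x} → x ∈ W → ∃[ ε ] 0ℚ ℚ.< ε × (∀ {y} → d x y <ᴿ fromℚ ε → y ∈ W))

  Complete : (Carrier → Carrier → ℝ) → Set c
  Complete d = (u : ℕ → Carrier) →
    (∀ {ε} → 0ℚ ℚ.< ε → ∃[ N ] ∀ {m n} → N ℕ.≤ m → N ℕ.≤ n → d (u m) (u n) <ᴿ fromℚ ε) →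
    ∃[ x ] ∀ {ε} → 0ℚ ℚ.< ε → ∃[ N ] ∀ {n} → N ℕ.≤ n → d (u n) x <ᴿ fromℚ ε

  -- The countable dense set is enumerated by a partial sequence, so that the
  -- empty space is separable.
  Separable : Set (c ⊔ o ⊔ lsuc 0ℓ)
  Separable = Σ[ e ∈ (ℕ → Maybe Carrier) ]
    ∀ {W} → Open W → Satisfiable W → ∃[ n ] ∃[ x ] e n ≡ just x × x ∈ W

  Polish : Set (c ⊔ ℓ ⊔ o ⊔ lsuc 0ℓ)
  Polish = Separable × Σ[ d ∈ (Carrier → Carrier → ℝ) ] IsMetric d × Induces d × Complete d

BorelMap : (X : Space c ℓ o) (Y : Space c′ ℓ′ o′) →
           Func (Space.setoid X) (Space.setoid Y) → Set _
BorelMap X Y f = ∀ {B} → Borel Y B → Borel X (Func.to f ⊢ B)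

record ContinuousMap (X : Space c ℓ o) (Y : Space c′ ℓ′ o′) :
                     Set (c ⊔ ℓ ⊔ o ⊔ c′ ⊔ ℓ′ ⊔ o′ ⊔ lsuc 0ℓ) where
  private
    module X = Space X
    module Y = Space Y
  field
    func       : Func X.setoid Y.setoid
  open Func func public using (to; cong)
  field
    continuous : ∀ {W} → Y.Open W → X.Open (to ⊢ W)
open ContinuousMap using (to)

-- The sets C below need not respect the equality of X: this adds no open set, as
-- C may be replaced by its saturation, which is compact and gives the same set.
data CompactOpen (X Y : Space 0ℓ 0ℓ 0ℓ) : Pred (Pred (ContinuousMap X Y) 0ℓ) (lsuc 0ℓ) where
  compact-open : ∀ {C V} → Compact X C → Space.Open Y V → CompactOpen X Y (λ f → C ⊆ to f ⊢ V)

Map : Space 0ℓ 0ℓ 0ℓ → Space 0ℓ 0ℓ 0ℓ → Space (lsuc 0ℓ) 0ℓ (lsuc 0ℓ)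
Map X Y = generated maps (CompactOpen X Y) resp
  where
  module X = Space X
  module Y = Space Y

  maps : Setoid (lsuc 0ℓ) 0ℓ
  maps = record
    { Carrier       = ContinuousMap X Y
    ; _≈_           = λ f g → ∀ x → to f x Y.≈ to g x
    ; isEquivalence = record
      { refl  = λ _ → Setoid.refl Y.setoid
      ; sym   = λ f≈g x → Setoid.sym Y.setoid (f≈g x)
      ; trans = λ f≈g g≈h x → Setoid.trans Y.setoid (f≈g x) (g≈h x)
      }
    }

  resp : ∀ {B} → B ∈ CompactOpen X Y → B Respects Setoid._≈_ maps
  resp (compact-open _ V-open) f≈g C⊆ {x} x∈C = Y.open-resp V-open (f≈g x) (C⊆ x∈C)

-- The vertex set is ℕ.  A finite set is given by a list of its elements; order
-- and repetitions are immaterial, by face.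
record SimplicialComplex : Set₁ where
  field
    Simplex  : Pred (List ℕ) 0ℓ
    nonempty : ∀ {σ} → Simplex σ → σ ≢ []
    face     : ∀ {σ τ} → Simplex τ → σ ≢ [] → σ ⊆ᴸ τ → Simplex σ
    vertex   : ∀ v → Simplex (v ∷ [])
open SimplicialComplex

-- Every vertex lies in finitely many simplices.
LocallyFiniteComplex : SimplicialComplex → Set
LocallyFiniteComplex K = ∀ v → Σ[ τs ∈ List (List ℕ) ]
  (∀ {σ} → Simplex K σ → v ∈ᴸ σ → Any (λ τ → σ ⊆ᴸ τ × τ ⊆ᴸ σ) τs)

record Point (K : SimplicialComplex) : Set where
  field
    coord     : ℕ → ℝ
    coord≥0   : ∀ v → 0ᴿ ≤ᴿ coord v
    support   : List ℕ
    distinct  : Unique support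
    isSimplex : Simplex K support
    isSupport : ∀ {v} → v ∈ᴸ support ⇔ 0ᴿ <ᴿ coord v
    sum≈1     : foldr (λ v s → coord v +ᴿ s) 0ᴿ support ≈ᴿ 1ᴿ
open Point

closedSimplex : ∀ {K} → List ℕ → Pred (Point K) 0ℓ
closedSimplex σ x = ∀ {v} → 0ᴿ <ᴿ coord x v → v ∈ᴸ σ

St : (K : SimplicialComplex) → ℕ → Pred (Point K) 0ℓ
St K v x = 0ᴿ <ᴿ coord x v

-- The topological realization: a set is open when its trace on every closed
-- simplex is open in the Euclidean topology of that simplex.
∣_∣ᵀ : SimplicialComplex → Space 0ℓ 0ℓ 0ℓ
∣ K ∣ᵀ = record
  { setoid    = points
  ; Open      = λ W → W Respects _≈_ × (∀ {σ} → Simplex K σ → OpenIn σ W)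
  ; open-resp = proj₁
  ; open-full = (λ _ _ → tt) , λ _ _ _ → 1ℚ , ℚₚ.positive⁻¹ 1ℚ , λ _ _ → tt
  ; open-∩    = λ (V-resp , V-open) (W-resp , W-open) →
      (λ x≈y (x∈V , x∈W) → V-resp x≈y x∈V , W-resp x≈y x∈W) ,
      λ σ∈K {x} x∈σ (x∈V , x∈W) →
        let δ , δ>0 , p = V-open σ∈K x∈σ x∈V
            ε , ε>0 , q = W-open σ∈K x∈σ x∈W
        in δ ℚ.⊓ ε , ⊓>0 δ>0 ε>0 , λ {y} y∈σ near →
             p y∈σ (λ {v} v∈σ → within-widen {coord x v} {coord y v} (ℚₚ.p⊓q≤p δ ε) (near v∈σ)) ,
             q y∈σ (λ {v} v∈σ → within-widen {coord x v} {coord y v} (ℚₚ.p⊓q≤q δ ε) (near v∈σ))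
  ; open-⋃    = λ nbhd →
      (λ x≈y x∈W → let V , (V-resp , _) , x∈V , V⊆W = nbhd x∈W in V⊆W (V-resp x≈y x∈V)) ,
      λ σ∈K x∈σ x∈W →
        let V , (_ , V-open) , x∈V , V⊆W = nbhd x∈W
            ε , ε>0 , p = V-open σ∈K x∈σ x∈V
        in ε , ε>0 , λ y∈σ near → V⊆W (p y∈σ near)
  }
  where
  points : Setoid 0ℓ 0ℓ
  points = record
    { Carrier       = Point K
    ; _≈_           = λ x y → ∀ v → coord x v ≈ᴿ coord y v
    ; isEquivalence = record
      { refl  = λ {x} v → ≤ᴿ-refl {coord x v} , ≤ᴿ-refl {coord x v}
      ; sym   = λ x≈y v → swap (x≈y v)
      ; trans = λ {x} {y} {z} x≈y y≈z v →
          ≤ᴿ-trans {coord x v} {coord y v} {coord z v} (proj₁ (x≈y v)) (proj₁ (y≈z v)) ,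
          ≤ᴿ-trans {coord z v} {coord y v} {coord x v} (proj₂ (y≈z v)) (proj₂ (x≈y v))
      }
    }
  open Setoid points using (_≈_)

  OpenIn : List ℕ → Pred (Point K) 0ℓ → Set
  OpenIn σ W = ∀ {x} → x ∈ closedSimplex σ → x ∈ W →
    ∃[ ε ] 0ℚ ℚ.< ε × (∀ {y} → y ∈ closedSimplex σ →
      (∀ {v} → v ∈ᴸ σ → coord x v within fromℚ ε of coord y v) → y ∈ W)

record 𝒩* : Set where
  field
    at   : ℕ → ℕ
    mono : ∀ {m n} → m ℕ.≤ n → at m ℕ.≤ at n
open 𝒩* public

infix 4 _≤*_
record _≤*_ (α β : 𝒩*) : Set where
  constructor pointwise
  field
    at-≤ : ∀ i → at α i ℕ.≤ at β i
open _≤*_ public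

-- α|n = β|n
infix 4 _≡[_]_
_≡[_]_ : 𝒩* → ℕ → 𝒩* → Set
α ≡[ n ] β = ∀ {i} → i ℕ.< n → at α i ≡ at β i

Family : Set → Set₁
Family X = Pred (Pred X 0ℓ) 0ℓ

-- The members of a family, to be compared by ≐ on their first components.
Members : ∀ {X} → Family X → Set₁
Members 𝓤 = ∃[ U ] U ∈ 𝓤

infixl 8 _↾_
_↾_ : ∀ {X} → Family X → Pred X 0ℓ → Family X
(𝓤 ↾ C) U = U ∈ 𝓤 × U ≬ C

infix 4 _⪯_
_⪯_ : ∀ {X} → Family X → Family X → Set₁
𝓤 ⪯ 𝓥 = Σ[ r ∈ (Members 𝓥 → Members 𝓤) ] ∀ V → proj₁ V ⊆ proj₁ (r V)

module _ (X : Space 0ℓ 0ℓ 0ℓ) where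
  open Space X

  record OpenCover (𝓤 : Family Carrier) : Set₁ where
    field
      isOpen : ∀ {U} → U ∈ 𝓤 → Open U
      covers : ∀ x → ∃[ U ] U ∈ 𝓤 × x ∈ U

  LocallyFiniteFamily : Family Carrier → Set₁
  LocallyFiniteFamily 𝓤 = ∀ x → ∃[ V ] Open V × x ∈ V ×
    Σ[ Us ∈ List (Pred Carrier 0ℓ) ] (∀ {U} → U ∈ 𝓤 → U ≬ V → Any (U ≐_) Us)

  record CoveringSystem : Set₁ where
    field
      Xₙ         : ℕ → Pred Carrier 0ℓ
      Xₙ-resp    : ∀ n → Xₙ n Respects _≈_
      X₀-empty   : Empty (Xₙ 0)
      Xₙ-mono    : ∀ n → Xₙ n ⊆ Xₙ (suc n)
      Xₙ-compact : ∀ n → Compact X (Xₙ n)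
      Xₙ-exhaust : ∀ x → ∃[ n ] x ∈ Xₙ n

      -- 𝓤-resp, 𝓤-cong and r-cong say that each 𝓤 α is a set of subsets of X
      -- and that 𝓤 and r are functions, for the extensional equality of
      -- subsets and of sequences.
      𝓤          : 𝒩* → Family Carrier
      𝓤-resp     : ∀ α → 𝓤 α Respects _≐_
      𝓤-cong     : ∀ {α β} → at α ≗ at β → 𝓤 α ≐ 𝓤 β
      𝓤-cover    : ∀ α → OpenCover (𝓤 α)
      𝓤-locFin   : ∀ α → LocallyFiniteFamily (𝓤 α)

      r          : ∀ {α β} → α ≤* β → Members (𝓤 β) → Members (𝓤 α)
      r-cong     : ∀ {α β γ δ} (p : α ≤* β) (q : γ ≤* δ) → at α ≗ at γ → at β ≗ at δ →
                   ∀ U V → proj₁ U ≐ proj₁ V → proj₁ (r p U) ≐ proj₁ (r q V)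
      r-refines  : ∀ {α β} (p : α ≤* β) U → proj₁ U ⊆ proj₁ (r p U)
      r-id       : ∀ {α} (p : α ≤* α) U → proj₁ (r p U) ≐ proj₁ U
      r-comp     : ∀ {α β γ} (p : α ≤* β) (q : β ≤* γ) (s : α ≤* γ) U →
                   proj₁ (r s U) ≐ proj₁ (r p (r q U))

      L1 : ∀ n {α β} → α ≡[ n ] β → 𝓤 α ↾ Xₙ n ≐ 𝓤 β ↾ Xₙ n
      -- U and V are the same set, seen as a member of 𝓤 β and of 𝓤 δ.
      L2 : ∀ n {α β γ δ} (p : α ≤* β) (q : γ ≤* δ) →
           α ≡[ n ] γ → β ≡[ n ] δ →
           (U : Members (𝓤 β)) (V : Members (𝓤 δ)) → proj₁ U ≐ proj₁ V →
           proj₁ U ≬ Xₙ n → proj₁ (r p U) ≐ proj₁ (r q V)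
      -- Only surjectivity is required: r maps 𝓤 β ↾ Xₙ n into 𝓤 α ↾ Xₙ n
      -- already by r-refines.
      L3 : ∀ n {α β} (p : α ≤* β) (V : Members (𝓤 α)) → proj₁ V ≬ Xₙ n →
           Σ[ U ∈ Members (𝓤 β) ] proj₁ U ≬ Xₙ n × proj₁ (r p U) ≐ proj₁ V
      E1 : ∀ n {𝓦} → OpenCover 𝓦 → ∀ {m} → n ℕ.< m → ∀ {α} →
           𝓦 ↾ Xₙ n ⪯ 𝓤 α ↾ Xₙ n →
           ∃[ β ] β ≡[ n ] α × 𝓦 ↾ Xₙ m ⪯ 𝓤 β ↾ Xₙ m

-- The nerve: nonempty finite subsets with a common point.
Nerve : ∀ {X} (𝓤 : Family X) → Pred (List (Members 𝓤)) (lsuc 0ℓ)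
Nerve 𝓤 σ = σ ≢ [] × ∃[ x ] All (λ U → x ∈ proj₁ U) σ

module _ {X : Space 0ℓ 0ℓ 0ℓ} (𝐔 : CoveringSystem X) where
  open Space X using (Carrier)
  open CoveringSystem 𝐔

  -- S = ⋃ 𝓤 α; the index α witnessing membership is irrelevant to equality.
  S : Set₁
  S = ∃[ U ] ∃[ α ] U ∈ 𝓤 α

  S-setoid : Setoid (lsuc 0ℓ) 0ℓ
  S-setoid = record { isEquivalence = On.isEquivalence {B = S} proj₁ (Setoid.isEquivalence (≐-setoid Carrier 0ℓ)) }

  member : ∀ {α} → Members (𝓤 α) → S
  member {α} (U , U∈) = U , α , U∈

  record SAPair (K : SimplicialComplex) : Set₁ where
    field
      α          : 𝒩*
      p          : Func S-setoid (≡.setoid ℕ)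
    p[_] : S → ℕ
    p[_] = Func.to p
    field
      simplicial : ∀ σ → σ ∈ Nerve (𝓤 α) → Simplex K (map (p[_] ∘ member) σ)
      vanishing  : ∀ s → proj₁ s ∉ 𝓤 α → p[ s ] ≡ 0
  open SAPair

  data FixValue (K : SimplicialComplex) : Pred (Pred (SAPair K) 0ℓ) (lsuc 0ℓ) where
    fix-α : ∀ i k → FixValue K (λ a → at (α a) i ≡ k)
    fix-p : ∀ s k → FixValue K (λ a → p[ a ] s ≡ k)

  -- The subspace topology from 𝒩* × ℕ^S, 𝒩* being a subspace of Baire space ℕ^ℕ.
  SA : SimplicialComplex → Space (lsuc 0ℓ) (lsuc 0ℓ) (lsuc 0ℓ)
  SA K = generated pairs (FixValue K) resp
    where
    pairs : Setoid (lsuc 0ℓ) (lsuc 0ℓ)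
    pairs = record
      { Carrier       = SAPair K
      ; _≈_           = λ a b → at (α a) ≗ at (α b) × p[ a ] ≗ p[ b ]
      ; isEquivalence = record
        { refl  = (λ _ → ≡.refl) , (λ _ → ≡.refl)
        ; sym   = λ (e , f) → (λ i → ≡.sym (e i)) , (λ s → ≡.sym (f s))
        ; trans = λ (e , f) (e′ , f′) → (λ i → ≡.trans (e i) (e′ i)) , (λ s → ≡.trans (f s) (f′ s))
        }
      }

    resp : ∀ {B} → B ∈ FixValue K → B Respects Setoid._≈_ pairs
    resp (fix-α i k) (e , _) eq = ≡.trans (≡.sym (e i)) eq
    resp (fix-p s k) (_ , e) eq = ≡.trans (≡.sym (e s)) eq

{-# OPTIONS --safe #-}

-- The stars of K pull back along f to an open cover of X.  By (E1) it is refined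
-- over X₁, X₂, … by covers 𝓤 α with longer and longer prefixes of α fixed; taking
-- the least possible next value of α each time gives α_f, and p_f U is the least
-- vertex whose star contains f(U).  An open U ⊆ X is a countable union of compact
-- sets Xₙ ∩ {x | the 1/(k+1)-ball at x lies in U}, so "f(U) lies in the star of v"
-- is a Borel condition on f.  Finally, membership of (α_f , p_f) in a basic open
-- set depends only on α_f|n and on the values of p_f at the finitely many members
-- of 𝓤 α_f ↾ Xₙ, for some n: this is a countable amount of data.
module Submission where

open import Level using (Level; 0ℓ; _⊔_) renaming (suc to lsuc)
open import Axiom.DoubleNegationElimination using (em⇒dne)
open import Axiom.ExcludedMiddle using (ExcludedMiddle)
open import Data.Empty using (⊥)
open import Data.Integer.Base as ℤ using (+_; -[1+_])
open import Data.List.Base using (List; []; _∷_; _++_; filter; length; map)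
open import Data.List.Membership.Propositional using () renaming (_∈_ to _∈ᴸ_)
open import Data.List.Properties using (∷-injective)
open import Data.List.Relation.Unary.All as All using (All; []; _∷_)
import Data.List.Relation.Unary.All.Properties as Allₚ
open import Data.List.Relation.Unary.Any using (Any; here; there)
import Data.List.Relation.Unary.Any.Properties as Anyₚ
open import Data.Nat.Base as ℕ using (ℕ; zero; suc; _≤_; _<_; _∸_; _≤′_; ≤′-refl; ≤′-step; z≤n; s≤s)
open import Data.Nat.Coprimality using (1-coprimeTo)
open import Data.Nat.Induction using (<-wellFounded)
open import Data.Nat.ListAction using (sum)
import Data.Nat.Properties as ℕₚ
open import Data.Product.Base using (Σ-syntax; ∃-syntax; _×_; _,_; proj₁; proj₂)
open import Data.Rational.Base as ℚ using (ℚ; mkℚ; 0ℚ; ½)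
import Data.Rational.Properties as ℚₚ
open import Data.Sum.Base using (_⊎_; inj₁; inj₂)
open import Data.Unit.Base using (⊤; tt)
open import Function.Base using (_∘_; id)
open import Function.Bundles using (Func; module Equivalence)
open import Induction.WellFounded using (Acc; acc)
open import Relation.Binary.Bundles using (Setoid)
open import Relation.Binary.Definitions using (_Respects_; tri<; tri≈; tri>)
open import Relation.Binary.PropositionalEquality as ≡ using (_≡_; _≗_; refl; cong; cong₂; subst)
open import Relation.Nullary using (¬_; Dec; yes; no; contradiction)
open import Relation.Nullary.Decidable using (True; toWitness; fromWitness)
open import Relation.Unary using (Pred; _∈_; _∉_; _⊆_; _≐_; _∩_; _∪_; ∁; _≬_; _⊢_; ⋃; ⋂; Satisfiable)
open import Relation.Unary.Properties using (≐-refl; ≐-sym)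
open import Defs

private
  variable
    a c ℓ o p q : Level

-- Rational and real estimates

halve : ∀ {ε} → 0ℚ ℚ.< ε → ∃[ δ ] 0ℚ ℚ.< δ × δ ℚ.+ δ ≡ ε
halve {ε} ε>0 =
  ½ ℚ.* ε , subst (ℚ._< ½ ℚ.* ε) (ℚₚ.*-zeroʳ ½) (ℚₚ.*-monoʳ-<-pos ½ ε>0) ,
  ≡.trans (≡.sym (ℚₚ.*-distribʳ-+ ε ½ ½)) (ℚₚ.*-identityˡ ε)

+-cancelʳ-≤ : ∀ r {p q} → p ℚ.+ r ℚ.≤ q ℚ.+ r → p ℚ.≤ q
+-cancelʳ-≤ r p+r≤q+r = ℚₚ.≮⇒≥ λ q<p →
  ℚₚ.<-irrefl refl (ℚₚ.<-≤-trans (ℚₚ.+-monoˡ-< r q<p) p+r≤q+r)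

unitFraction : ℕ → ℚ
unitFraction k = mkℚ (+ 1) k (1-coprimeTo (suc k))

unitFraction>0 : ∀ k → 0ℚ ℚ.< unitFraction k
unitFraction>0 k = ℚₚ.positive⁻¹ (unitFraction k)

-- A positive numerator is at least 1, so the reciprocal of the denominator is small enough. `mkℚ`
-- stores the denominator less one, which is just the index that `unitFraction` takes.
∃unitFraction≤ : ∀ {ε} → 0ℚ ℚ.< ε → ∃[ k ] unitFraction k ℚ.≤ ε
∃unitFraction≤ {mkℚ (+ suc n) d _} _ =
  d , ℚ.*≤* (ℤ.+≤+ (ℕₚ.*-monoˡ-≤ (suc d) (s≤s (z≤n {n}))))
∃unitFraction≤ {mkℚ (+ 0) _ _} (ℚ.*<* (ℤ.+<+ ()))
∃unitFraction≤ {mkℚ -[1+ _ ] _ _} (ℚ.*<* ())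

fromℚ-mono-< : ∀ {p q} → p ℚ.≤ q → ∀ {x} → x <ᴿ fromℚ p → x <ᴿ fromℚ q
fromℚ-mono-< p≤q (*<* g>0 (N , sep)) = *<* g>0 (N , λ n≥ → ℚₚ.≤-trans (sep n≥) p≤q)

fromℚ-pos : ∀ {q} → 0ℚ ℚ.< q → 0ᴿ <ᴿ fromℚ q
fromℚ-pos {q} q>0 = *<* q>0 (0 , λ _ → ℚₚ.≤-reflexive (ℚₚ.+-identityˡ q))

-- Half of the gap absorbs the error allowed by `≤ᴿ`; the other half remains as the new gap.
≤ᴿ-<ᴿ-trans : ∀ {x y z} → x ≤ᴿ y → y <ᴿ z → x <ᴿ z
≤ᴿ-<ᴿ-trans {x} {y} {z} (*≤* approx) (*<* {g} g>0 (N , sep)) with halve g>0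
... | h , h>0 , refl with approx h>0
... | M , x≤y = *<* h>0 (M ℕ.⊔ N , λ {n} n≥ → begin
  ℝ.seq x n ℚ.+ h               ≤⟨ ℚₚ.+-monoˡ-≤ h (x≤y (ℕₚ.m⊔n≤o⇒m≤o M N n≥)) ⟩
  (ℝ.seq y n ℚ.+ h) ℚ.+ h       ≡⟨ ℚₚ.+-assoc (ℝ.seq y n) h h ⟩
  ℝ.seq y n ℚ.+ (h ℚ.+ h)       ≤⟨ sep (ℕₚ.m⊔n≤o⇒n≤o M N n≥) ⟩
  ℝ.seq z n                     ∎)
  where open ℚₚ.≤-Reasoning

<ᴿ-≤ᴿ-trans : ∀ {x y z} → x <ᴿ y → y ≤ᴿ z → x <ᴿ z
<ᴿ-≤ᴿ-trans {x} {y} {z} (*<* {g} g>0 (N , sep)) (*≤* approx) with halve g>0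
... | h , h>0 , refl with approx h>0
... | M , y≤z = *<* h>0 (M ℕ.⊔ N , λ {n} n≥ → +-cancelʳ-≤ h (begin
  (ℝ.seq x n ℚ.+ h) ℚ.+ h       ≡⟨ ℚₚ.+-assoc (ℝ.seq x n) h h ⟩
  ℝ.seq x n ℚ.+ (h ℚ.+ h)       ≤⟨ sep (ℕₚ.m⊔n≤o⇒n≤o M N n≥) ⟩
  ℝ.seq y n                     ≤⟨ y≤z (ℕₚ.m⊔n≤o⇒m≤o M N n≥) ⟩
  ℝ.seq z n ℚ.+ h               ∎))
  where open ℚₚ.≤-Reasoning

-- For use with the triangle inequality: the gap of a strict inequality serves as the radius of a
-- ball on which the inequality persists.
+ᴿ-<ᴿ-gap : ∀ {x y z} (x<y : x <ᴿ y) → z <ᴿ fromℚ (_<ᴿ_.gap x<y) → x +ᴿ z <ᴿ y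
+ᴿ-<ᴿ-gap {x} {y} {z} (*<* {g} _ (N , sep)) (*<* {h} h>0 (M , sep′)) =
  *<* h>0 (M ℕ.⊔ N , λ {n} n≥ → begin
    (ℝ.seq x n ℚ.+ ℝ.seq z n) ℚ.+ h   ≡⟨ ℚₚ.+-assoc (ℝ.seq x n) (ℝ.seq z n) h ⟩
    ℝ.seq x n ℚ.+ (ℝ.seq z n ℚ.+ h)   ≤⟨ ℚₚ.+-monoʳ-≤ (ℝ.seq x n) (sep′ (ℕₚ.m⊔n≤o⇒m≤o M N n≥)) ⟩
    ℝ.seq x n ℚ.+ g                   ≤⟨ sep (ℕₚ.m⊔n≤o⇒n≤o M N n≥) ⟩
    ℝ.seq y n                         ∎)
  where open ℚₚ.≤-Reasoning

-- The radius is half the gap: losing at most that much leaves the other half as a gap above 0.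
positive-nearby : ∀ {x} → 0ᴿ <ᴿ x →
  ∃[ ε ] 0ℚ ℚ.< ε × (∀ {y} → x <ᴿ y +ᴿ fromℚ ε → 0ᴿ <ᴿ y)
positive-nearby {x} (*<* {g} g>0 (N , sep)) with halve g>0
... | h , h>0 , refl = h , h>0 , λ { {y} (*<* {k} k>0 (M , near)) →
  *<* h>0 (M ℕ.⊔ N , λ {n} n≥ → +-cancelʳ-≤ h (begin
    (0ℚ ℚ.+ h) ℚ.+ h      ≡⟨ ℚₚ.+-assoc 0ℚ h h ⟩
    0ℚ ℚ.+ (h ℚ.+ h)      ≤⟨ sep (ℕₚ.m⊔n≤o⇒n≤o M N n≥) ⟩
    ℝ.seq x n             ≡⟨ ℚₚ.+-identityʳ (ℝ.seq x n) ⟨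
    ℝ.seq x n ℚ.+ 0ℚ      ≤⟨ ℚₚ.+-monoʳ-≤ (ℝ.seq x n) (ℚₚ.<⇒≤ k>0) ⟩
    ℝ.seq x n ℚ.+ k       ≤⟨ near (ℕₚ.m⊔n≤o⇒m≤o M N n≥) ⟩
    ℝ.seq y n ℚ.+ h       ∎)) }
  where open ℚₚ.≤-Reasoning

-- Open stars and basic open sets

St-open : ∀ K v → Space.Open ∣ K ∣ᵀ (St K v)
St-open K v =
  (λ {x} {y} x≈y 0<x → <ᴿ-≤ᴿ-trans {0ᴿ} {Point.coord x v} {Point.coord y v} 0<x (proj₁ (x≈y v))) ,
  λ _ {x} x∈σ 0<x →
    let ε , ε>0 , near⇒pos = positive-nearby {Point.coord x v} 0<x
    -- Closeness is only known at the vertices of `σ`; positivity of the coordinate puts `v` among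
    -- them.
    in ε , ε>0 , λ {y} _ near → near⇒pos {Point.coord y v} (proj₁ (near (x∈σ 0<x)))

St-cover : ∀ {K} (x : Point K) → ∃[ v ] x ∈ St K v
St-cover {K} x with Point.support x in eq | Point.isSimplex x
... | []    | σ∈K = contradiction refl (SimplicialComplex.nonempty K σ∈K)
... | v ∷ _ | _   = v , Equivalence.to (Point.isSupport x) (subst (v ∈ᴸ_) (≡.sym eq) (here refl))

compact-open-isOpen : ∀ X Y → CompactOpen X Y ⊆ Space.Open (Map X Y)
compact-open-isOpen X Y {B} B∈ f∈B = B ∷ [] , B∈ ∷ [] , f∈B ∷ [] , λ { (g∈B ∷ []) → g∈B }

module _ (X : Space c ℓ o) where
  open Space X

  Open-resp-≐ : Open Respects _≐_
  Open-resp-≐ {V} (V⊆W , W⊆V) V-open = open-⋃ λ x∈W → V , V-open , W⊆V x∈W , V⊆W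

-- Coding prefixes of non-decreasing sequences

-- Increments are listed latest first; their partial sums form the beginning of
-- a sequence that is constant afterwards.
partialSum : List ℕ → ℕ → ℕ
partialSum []       _ = 0
partialSum (k ∷ ks) i with i ℕₚ.<? length ks
... | yes _ = partialSum ks i
... | no _  = k ℕ.+ sum ks

partialSum-< : ∀ k ks {i} → i < length ks → partialSum (k ∷ ks) i ≡ partialSum ks i
partialSum-< k ks {i} i<n with i ℕₚ.<? length ks
... | yes _  = refl
... | no i≮n = contradiction i<n i≮n

partialSum-≥ : ∀ k ks {i} → length ks ≤ i → partialSum (k ∷ ks) i ≡ k ℕ.+ sum ks
partialSum-≥ k ks {i} n≤i with i ℕₚ.<? length ks
... | yes i<n = contradiction n≤i (ℕₚ.<⇒≱ i<n)
... | no _    = refl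

partialSum≤sum : ∀ ks i → partialSum ks i ≤ sum ks
partialSum≤sum []       _ = z≤n
partialSum≤sum (k ∷ ks) i with i ℕₚ.<? length ks
... | yes _ = ℕₚ.≤-trans (partialSum≤sum ks i) (ℕₚ.m≤n+m (sum ks) k)
... | no _  = ℕₚ.≤-refl

partialSum-mono : ∀ ks {i j} → i ≤ j → partialSum ks i ≤ partialSum ks j
partialSum-mono []       _ = z≤n
partialSum-mono (k ∷ ks) {i} {j} i≤j with i ℕₚ.<? length ks | j ℕₚ.<? length ks
... | yes _  | yes _   = partialSum-mono ks i≤j
... | yes _  | no _    = ℕₚ.≤-trans (partialSum≤sum ks i) (ℕₚ.m≤n+m (sum ks) k)
... | no i≮n | yes j<n = contradiction (ℕₚ.≤-<-trans i≤j j<n) i≮n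
... | no _   | no _    = ℕₚ.≤-refl

-- With increments in place of values, every list of naturals codes a prefix, so the choice of a
-- next entry is subject to no monotonicity condition.
partialSums : List ℕ → 𝒩*
partialSums ks = record { at = partialSum ks ; mono = partialSum-mono ks }

-- The truncated subtraction is exact: `sum ks` is the last value already fixed, or 0 if there is
-- none, and `α` is non-decreasing.
∃partialSums : ∀ {α} ks → α ≡[ length ks ] partialSums ks →
               ∃[ k ] α ≡[ suc (length ks) ] partialSums (k ∷ ks)
∃partialSums {α} ks α≡ = at α n ∸ sum ks , agree
  where
  n = length ks

  sum≤ : ∀ ks → α ≡[ length ks ] partialSums ks → sum ks ≤ at α (length ks)
  sum≤ []       _  = z≤n
  sum≤ (k ∷ ks) α≡ = ℕₚ.≤-trans
    (ℕₚ.≤-reflexive (≡.sym (≡.trans (α≡ ℕₚ.≤-refl) (partialSum-≥ k ks ℕₚ.≤-refl))))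
    (mono α (ℕₚ.n≤1+n _))

  agree : α ≡[ suc n ] partialSums ((at α n ∸ sum ks) ∷ ks)
  agree {i} i≤n with i ℕₚ.<? n
  ... | yes i<n = α≡ i<n
  ... | no i≮n  = ≡.trans (cong (at α) (ℕₚ.≤-antisym (ℕₚ.≤-pred i≤n) (ℕₚ.≮⇒≥ i≮n)))
                          (≡.sym (ℕₚ.m∸n+n≡m (sum≤ ks α≡)))

module _ (em : ∀ {ℓ} → ExcludedMiddle ℓ) where

  -- Least elements

  IsLeast : Pred ℕ p → Pred ℕ p
  IsLeast P n = n ∈ P × (∀ m → m < n → m ∉ P)

  IsLeast-unique : ∀ {P : Pred ℕ p} {m n} → IsLeast P m → IsLeast P n → m ≡ n
  IsLeast-unique {m = m} {n} (m∈P , <m∉P) (n∈P , <n∉P) with ℕₚ.<-cmp m n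
  ... | tri< m<n _ _ = contradiction m∈P (<n∉P m m<n)
  ... | tri≈ _ m≡n _ = m≡n
  ... | tri> _ _ n<m = contradiction n∈P (<m∉P n n<m)

  ∃IsLeast : {P : Pred ℕ p} → Satisfiable P → Satisfiable (IsLeast P)
  ∃IsLeast {P = P} (n , n∈P) = go n∈P (<-wellFounded n)
    where
    go : ∀ {n} → n ∈ P → Acc _<_ n → Satisfiable (IsLeast P)
    go {n} n∈P (acc rs) with em {P = ∃[ m ] m < n × m ∈ P}
    ... | yes (m , m<n , m∈P) = go m∈P (rs m<n)
    ... | no ∄                = n , n∈P , λ m m<n m∈P → ∄ (m , m<n , m∈P)

  -- The value is 0 when P is empty.
  least : Pred ℕ p → ℕ
  least P with em {P = Satisfiable P}
  ... | yes ∃P = proj₁ (∃IsLeast ∃P)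
  ... | no _   = 0

  -- The graph of `least`, written as a countable Boolean combination of membership conditions;
  -- `least-measurable` relies on this form.
  LeastOrZero : Pred ℕ p → Pred ℕ p
  LeastOrZero P n = IsLeast P n ⊎ (n ≡ 0 × ¬ Satisfiable P)

  least-LeastOrZero : (P : Pred ℕ p) → LeastOrZero P (least P)
  least-LeastOrZero P with em {P = Satisfiable P}
  ... | yes ∃P = inj₁ (proj₂ (∃IsLeast ∃P))
  ... | no ∄P  = inj₂ (refl , ∄P)

  LeastOrZero-unique : ∀ {P : Pred ℕ p} {m n} → LeastOrZero P m → LeastOrZero P n → m ≡ n
  LeastOrZero-unique (inj₁ x) (inj₁ y) = IsLeast-unique x y
  LeastOrZero-unique (inj₁ x) (inj₂ (_ , ∄P)) = contradiction (_ , proj₁ x) ∄P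
  LeastOrZero-unique (inj₂ (_ , ∄P)) (inj₁ y) = contradiction (_ , proj₁ y) ∄P
  LeastOrZero-unique (inj₂ (refl , _)) (inj₂ (refl , _)) = refl

  least∈ : {P : Pred ℕ p} → Satisfiable P → least P ∈ P
  least∈ {P = P} ∃P with least-LeastOrZero P
  ... | inj₁ (l∈P , _) = l∈P
  ... | inj₂ (_ , ∄P)  = contradiction ∃P ∄P

  least-cong : {P : Pred ℕ p} {Q : Pred ℕ q} → P ≐ Q → least P ≡ least Q
  least-cong {P = P} {Q} (P⊆Q , Q⊆P) =
    LeastOrZero-unique (transport (least-LeastOrZero P)) (least-LeastOrZero Q)
    where
    transport : ∀ {n} → LeastOrZero P n → LeastOrZero Q n
    transport (inj₁ (n∈P , <n∉P)) = inj₁ (P⊆Q n∈P , λ m m<n → <n∉P m m<n ∘ Q⊆P)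
    transport (inj₂ (n≡0 , ∄P))   = inj₂ (n≡0 , λ (m , m∈Q) → ∄P (m , Q⊆P m∈Q))

  -- Closure properties of measurable predicates

  module Measurability (X : Space c ℓ o) where
    open Space X using (Carrier; Open)

    -- Borel X is confined to predicates in Set, whereas those met below may live
    -- in higher universes.
    Measurable : Pred Carrier p → Set (p ⊔ c ⊔ o ⊔ lsuc 0ℓ)
    Measurable P = Σ[ B ∈ Pred Carrier 0ℓ ] Borel X B × B ≐ P

    Measurable⇒Borel : ∀ {P : Pred Carrier 0ℓ} → Measurable P → Borel X P
    Measurable⇒Borel (_ , B-borel , B≐P) = resp-≐ B≐P B-borel

    Borel⇒Measurable : ∀ {P : Pred Carrier 0ℓ} → Borel X P → Measurable P
    Borel⇒Measurable B-borel = _ , B-borel , id , id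

    Measurable-resp : {P : Pred Carrier p} {Q : Pred Carrier q} →
                      P ≐ Q → Measurable P → Measurable Q
    Measurable-resp (P⊆Q , Q⊆P) (B , B-borel , B⊆P , P⊆B) = B , B-borel , P⊆Q ∘ B⊆P , P⊆B ∘ Q⊆P

    open-measurable : ∀ {W} → Open W → Measurable W
    open-measurable = Borel⇒Measurable ∘ open-set

    ∁-measurable : {P : Pred Carrier p} → Measurable P → Measurable (∁ P)
    ∁-measurable (B , B-borel , B⊆P , P⊆B) =
      ∁ B , complement B-borel , (λ x∉B → x∉B ∘ P⊆B) , (λ x∉P → x∉P ∘ B⊆P)

    ⋃-measurable : {P : ℕ → Pred Carrier p} → (∀ n → Measurable (P n)) → Measurable (⋃ ℕ P)
    ⋃-measurable P-meas =
      ⋃ ℕ (λ n → proj₁ (P-meas n)) , ⋃-ℕ (λ n → proj₁ (proj₂ (P-meas n))) ,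
      (λ (n , x∈) → n , proj₁ (proj₂ (proj₂ (P-meas n))) x∈) ,
      (λ (n , x∈) → n , proj₂ (proj₂ (proj₂ (P-meas n))) x∈)

    ⋂-measurable : {P : ℕ → Pred Carrier p} → (∀ n → Measurable (P n)) → Measurable (⋂ ℕ P)
    ⋂-measurable P-meas = Measurable-resp
      ((λ x∉ n → em⇒dne em λ x∉P → x∉ (n , x∉P)) , (λ x∈ (n , x∉P) → x∉P (x∈ n)))
      (∁-measurable (⋃-measurable (∁-measurable ∘ P-meas)))

    full-measurable : Measurable {0ℓ} (λ _ → ⊤)
    full-measurable = open-measurable (Space.open-full X)

    const-measurable : (A : Set a) → Measurable (λ _ → A)
    const-measurable A with em {P = A}
    ... | yes x = Measurable-resp ((λ _ → x) , (λ _ → tt)) full-measurable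
    ... | no ¬x = Measurable-resp ((λ ⊤∉ → contradiction tt ⊤∉) , (λ x → contradiction x ¬x))
                                  (∁-measurable full-measurable)

    ∪-measurable : {P : Pred Carrier p} {Q : Pred Carrier q} →
                   Measurable P → Measurable Q → Measurable (P ∪ Q)
    ∪-measurable (B , B-borel , B⊆P , P⊆B) (C , C-borel , C⊆Q , Q⊆C) = Measurable-resp
      ((λ { (zero , x∈B) → inj₁ (B⊆P x∈B) ; (suc _ , x∈C) → inj₂ (C⊆Q x∈C) }) ,
       (λ { (inj₁ x∈P) → 0 , P⊆B x∈P ; (inj₂ x∈Q) → 1 , Q⊆C x∈Q }))
      -- The binary union is that of the sequence B, C, C, and so on.
      (⋃-measurable {P = λ { zero → B ; (suc _) → C }}
        (λ { zero → Borel⇒Measurable B-borel ; (suc _) → Borel⇒Measurable C-borel }))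

    ∩-measurable : {P : Pred Carrier p} {Q : Pred Carrier q} →
                   Measurable P → Measurable Q → Measurable (P ∩ Q)
    ∩-measurable P-meas Q-meas = Measurable-resp
      ((λ x∉ → em⇒dne em (x∉ ∘ inj₁) , em⇒dne em (x∉ ∘ inj₂)) ,
       (λ { (x∈P , x∈Q) (inj₁ x∉P) → x∉P x∈P ; (x∈P , x∈Q) (inj₂ x∉Q) → x∉Q x∈Q }))
      (∁-measurable (∪-measurable (∁-measurable P-meas) (∁-measurable Q-meas)))

    const-⇒-measurable : {A : Set a} {P : Pred Carrier p} →
                         Measurable P → Measurable (λ x → A → x ∈ P)
    const-⇒-measurable {A = A} P-meas with em {P = A}
    ... | yes y = Measurable-resp ((λ x∈P _ → x∈P) , (λ f → f y)) P-meas
    ... | no ¬y = Measurable-resp ((λ _ y → contradiction y ¬y) , (λ _ → tt)) full-measurable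

    -- Lists are sorted by length, and for each length the union is an iterated union over ℕ, so no
    -- enumeration of lists is required.
    ⋃-List-measurable : {P : List ℕ → Pred Carrier p} →
                        (∀ l → Measurable (P l)) → Measurable (⋃ (List ℕ) P)
    ⋃-List-measurable P-meas = Measurable-resp
      ((λ (_ , l , _ , x∈) → l , x∈) , (λ (l , x∈) → length l , l , refl , x∈))
      (⋃-measurable λ n → ofLength n P-meas)
      where
      ofLength : ∀ n {P : List ℕ → Pred Carrier p} → (∀ l → Measurable (P l)) →
                 Measurable (λ x → ∃[ l ] length l ≡ n × x ∈ P l)
      ofLength zero P-meas = Measurable-resp
        ((λ x∈ → [] , refl , x∈) , (λ { ([] , _ , x∈) → x∈ })) (P-meas [])
      ofLength (suc n) P-meas = Measurable-resp
        ((λ (k , l , eq , x∈) → k ∷ l , cong suc eq , x∈) ,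
         (λ { (k ∷ l , eq , x∈) → k , l , ℕₚ.suc-injective eq , x∈ }))
        (⋃-measurable λ k → ofLength n (λ l → P-meas (k ∷ l)))

    All-measurable : {A : Set a} {P : Carrier → Pred A p} {xs : List A} →
                     All (λ x → Measurable (λ f → x ∈ P f)) xs → Measurable (λ f → All (P f) xs)
    All-measurable [] = Measurable-resp ((λ _ → []) , (λ _ → tt)) full-measurable
    All-measurable (x-meas ∷ xs-meas) = Measurable-resp
      ((λ (x∈ , xs∈) → x∈ ∷ xs∈) , (λ { (x∈ ∷ xs∈) → x∈ , xs∈ }))
      (∩-measurable x-meas (All-measurable xs-meas))

    map-measurable : {A : Set a} {h : Carrier → A → ℕ} {xs : List A} →
                     All (λ x → ∀ n → Measurable (λ f → h f x ≡ n)) xs →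
                     ∀ ns → Measurable (λ f → map (h f) xs ≡ ns)
    map-measurable [] ns = const-measurable ([] ≡ ns)
    map-measurable (_ ∷ _) [] = Measurable-resp
      ((λ ()) , (λ ())) (const-measurable ⊥)
    map-measurable (x-meas ∷ xs-meas) (n ∷ ns) = Measurable-resp
      ((λ (eq , eqs) → cong₂ _∷_ eq eqs) , ∷-injective)
      (∩-measurable (x-meas n) (map-measurable xs-meas ns))

    least-measurable : {P : Carrier → Pred ℕ p} → (∀ n → Measurable (λ x → n ∈ P x)) →
                       ∀ n → Measurable (λ x → least (P x) ≡ n)
    least-measurable {P = P} P-meas n = Measurable-resp
      ((λ {x} n∈ → LeastOrZero-unique (least-LeastOrZero (P x)) n∈) ,
       (λ { {x} refl → least-LeastOrZero (P x) }))
      (∪-measurable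
        (∩-measurable (P-meas n)
          (⋂-measurable λ m → const-⇒-measurable (∁-measurable (P-meas m))))
        (∩-measurable (const-measurable (n ≡ 0)) (∁-measurable (⋃-measurable P-meas))))

  -- Compactness and local finiteness

  module _ (X : Space c ℓ o) where
    open Space X

    -- The complement of `F` is added to the cover to cover all of `C`, then dropped from the finite
    -- subcover, since it contains no point of `F`.
    Compact-∩-closed : ∀ {C F} → Compact X C → Open (∁ F) → Compact X (C ∩ F)
    Compact-∩-closed {C} {F} C-compact ∁F-open 𝓦 𝓦-open 𝓦-covers =
      let Ws , Ws∈ , Ws-cover = C-compact 𝓦⁺ 𝓦⁺-open 𝓦⁺-covers
          Vs , Vs∈ , keep = discard Ws Ws∈
      in Vs , Vs∈ , λ (x∈C , x∈F) → keep x∈F (Ws-cover x∈C)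
      where
      𝓦⁺ : Pred (Pred Carrier 0ℓ) _
      -- `Compact` tests families whose membership lies in `Set`; `True` brings the equality, which
      -- lives at the level of `Carrier`, down to it.
      𝓦⁺ W = W ∈ 𝓦 ⊎ True (em {P = W ≐ ∁ F})

      𝓦⁺-open : 𝓦⁺ ⊆ Open
      𝓦⁺-open (inj₁ W∈𝓦) = 𝓦-open W∈𝓦
      𝓦⁺-open (inj₂ W≐∁F) = let W⊆∁F , ∁F⊆W = toWitness W≐∁F in
                             Open-resp-≐ X (∁F⊆W , W⊆∁F) ∁F-open

      𝓦⁺-covers : ∀ {x} → x ∈ C → ∃[ W ] W ∈ 𝓦⁺ × x ∈ W
      𝓦⁺-covers {x} x∈C with em {P = x ∈ F}
      ... | yes x∈F = let W , W∈𝓦 , x∈W = 𝓦-covers (x∈C , x∈F) in W , inj₁ W∈𝓦 , x∈W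
      ... | no x∉F  = ∁ F , inj₂ (fromWitness {a? = em} ≐-refl) , x∉F

      discard : ∀ Ws → All (_∈ 𝓦⁺) Ws → Σ[ Vs ∈ List (Pred Carrier 0ℓ) ]
        All (_∈ 𝓦) Vs × (∀ {x} → x ∈ F → Any (x ∈_) Ws → Any (x ∈_) Vs)
      discard [] [] = [] , [] , λ _ x∈ → x∈
      discard (W ∷ Ws) (W∈ ∷ Ws∈) with W∈ | discard Ws Ws∈
      ... | inj₁ W∈𝓦 | Vs , Vs∈ , keep =
        W ∷ Vs , W∈𝓦 ∷ Vs∈ , λ { x∈F (here x∈W) → here x∈W ; x∈F (there x∈) → there (keep x∈F x∈) }
      ... | inj₂ W≐∁F | Vs , Vs∈ , keep =
        Vs , Vs∈ , λ { x∈F (here x∈W) → contradiction x∈F (proj₁ (toWitness W≐∁F) x∈W)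
                     ; x∈F (there x∈) → keep x∈F x∈ }

  module _ (X : Space 0ℓ 0ℓ 0ℓ) where
    open Space X

    MeetsFinitely : Family Carrier → Pred Carrier p → Set (p ⊔ lsuc 0ℓ)
    MeetsFinitely 𝓤 V = Σ[ Us ∈ List (Pred Carrier 0ℓ) ]
      (∀ {U} → U ∈ 𝓤 → U ≬ V → Any (U ≐_) Us)

    -- The open sets that meet finitely many members cover `C`; the lists belonging to a finite
    -- subcover are concatenated.
    compact-meetsFinitely : ∀ {𝓤 C} → LocallyFiniteFamily X 𝓤 → Compact X C → MeetsFinitely 𝓤 C
    compact-meetsFinitely {𝓤} {C} locFin C-compact =
      let Vs , Vs∈ , Vs-cover = C-compact 𝓦 (proj₁ ∘ toWitness) 𝓦-covers
          Us , complete       = union Vs Vs∈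
      in Us , λ U∈𝓤 (x , x∈U , x∈C) → complete U∈𝓤 (x , x∈U , Vs-cover x∈C)
      where
      𝓦 : Family Carrier
      𝓦 V = True (em {P = Open V × MeetsFinitely 𝓤 V})

      𝓦-covers : ∀ {x} → x ∈ C → ∃[ V ] V ∈ 𝓦 × x ∈ V
      𝓦-covers {x} _ = let V , V-open , x∈V , finite = locFin x in
                       V , fromWitness {a? = em} (V-open , finite) , x∈V

      union : ∀ Vs → All (_∈ 𝓦) Vs → MeetsFinitely 𝓤 (λ x → Any (x ∈_) Vs)
      union [] [] = [] , λ { _ (_ , _ , ()) }
      union (V ∷ Vs) (V∈ ∷ Vs∈) =
        let _ , Us₁ , complete₁ = toWitness V∈
            Us₂ , complete₂     = union Vs Vs∈
        in Us₁ ++ Us₂ , λ { U∈𝓤 (x , x∈U , here x∈V)   → Anyₚ.++⁺ˡ (complete₁ U∈𝓤 (x , x∈U , x∈V))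
                          ; U∈𝓤 (x , x∈U , there x∈Vs) → Anyₚ.++⁺ʳ Us₁ (complete₂ U∈𝓤 (x , x∈U , x∈Vs)) }

    -- The list found above may contain sets outside the family, so it is filtered. No
    -- representative of a member is lost, because belonging to `𝓤 ↾ C` is invariant under `≐`.
    finite-↾ : ∀ {𝓤 C} → 𝓤 Respects _≐_ → LocallyFiniteFamily X 𝓤 → Compact X C →
      Σ[ Us ∈ List (Pred Carrier 0ℓ) ]
        All (_∈ 𝓤 ↾ C) Us × (∀ {U} → U ∈ 𝓤 ↾ C → Any (U ≐_) Us)
    finite-↾ {𝓤} {C} 𝓤-resp locFin C-compact =
      filter 𝓤↾C? Us , Allₚ.all-filter 𝓤↾C? Us , keep
      where
      Us = proj₁ (compact-meetsFinitely locFin C-compact)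

      𝓤↾C? : ∀ U → Dec (U ∈ 𝓤 ↾ C)
      𝓤↾C? _ = em

      keep : ∀ {U} → U ∈ 𝓤 ↾ C → Any (U ≐_) (filter 𝓤↾C? Us)
      keep (U∈𝓤 , U≬C@(x , x∈U , x∈C)) with proj₂ (compact-meetsFinitely locFin C-compact) U∈𝓤 U≬C
      ... | found with Anyₚ.filter⁺ 𝓤↾C? found | Anyₚ.lookup-result found
      ...   | inj₁ kept    | _   = kept
      ...   | inj₂ dropped | U≐V = contradiction (𝓤-resp U≐V U∈𝓤 , x , proj₁ U≐V x∈U , x∈C) dropped

    -- Exhausting open sets by closed sets

    module _ {d} (metric : IsMetric X d) (induces : Induces X d) where
      open IsMetric metric

      inner : Pred Carrier 0ℓ → ℕ → Pred Carrier 0ℓ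
      inner U k x = ∀ {y} → d y x <ᴿ fromℚ (unitFraction k) → y ∈ U

      -- If `x` is not in `inner U k`, some `y` outside `U` is strictly within the radius of `x`. It
      -- remains so for every `z` closer to `x` than the gap of that inequality, so `y` excludes `z`
      -- as well.
      inner-closed : ∀ U k → Open (∁ (inner U k))
      inner-closed U k = Equivalence.from induces λ {x} x∉ →
        em⇒dne em λ ∄ → x∉ λ {y} near → em⇒dne em λ y∉U →
          ∄ (_<ᴿ_.gap near , _<ᴿ_.gap>0 near , λ {z} z-near z∈ → y∉U (z∈ (
            ≤ᴿ-<ᴿ-trans {d y z} {d y x +ᴿ d x z} {fromℚ (unitFraction k)} (triangle y x z)
              (+ᴿ-<ᴿ-gap {d y x} {fromℚ (unitFraction k)} {d x z} near z-near))))

      inner⊆ : ∀ {U k} → inner U k ⊆ U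
      inner⊆ {k = k} {x} x∈ = x∈ (≤ᴿ-<ᴿ-trans {d x x} {0ᴿ} {fromℚ (unitFraction k)}
        (proj₁ (Equivalence.to zero-dist (Setoid.refl setoid))) (fromℚ-pos (unitFraction>0 k)))

      open⊆⋃inner : ∀ {U} → Open U → U ⊆ ⋃ ℕ (inner U)
      open⊆⋃inner {U} U-open {x} x∈U =
        let ε , ε>0 , ball⊆U = Equivalence.to induces U-open x∈U
            k , 1/k≤ε        = ∃unitFraction≤ ε>0
        in k , λ {y} near → ball⊆U (≤ᴿ-<ᴿ-trans {d x y} {d y x} {fromℚ ε} (proj₁ (symmetric x y))
                 (fromℚ-mono-< 1/k≤ε {d y x} near))

  module _ (X : Space 0ℓ 0ℓ 0ℓ) (𝐔 : CoveringSystem X)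
           (nonempty : ∀ α {U} → U ∈ CoveringSystem.𝓤 𝐔 α → Satisfiable U)
           (K : SimplicialComplex) where
    open Space X using (Carrier; Open)
    open CoveringSystem 𝐔
    open ContinuousMap using (to; continuous)

    private
      M = ContinuousMap X ∣ K ∣ᵀ
      Maps = Map X ∣ K ∣ᵀ

    -- Locality of the covers

    Xₙ-mono-≤ : ∀ {m n} → m ≤ n → Xₙ m ⊆ Xₙ n
    Xₙ-mono-≤ m≤n = go (ℕₚ.≤⇒≤′ m≤n)
      where
      go : ∀ {m n} → m ≤′ n → Xₙ m ⊆ Xₙ n
      go ≤′-refl          = id
      go (≤′-step {n} m≤n) = Xₙ-mono n ∘ go m≤n

    -- Nonemptiness of the members enters here. It brings each of them within reach of (L1), which
    -- only concerns sets meeting some `Xₙ n`.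
    meets-Xₙ : ∀ {α U} → U ∈ 𝓤 α → ∃[ n ] U ≬ Xₙ n
    meets-Xₙ {α} U∈𝓤 = let x , x∈U = nonempty α U∈𝓤
                           n , x∈Xₙ = Xₙ-exhaust x
                       in n , x , x∈U , x∈Xₙ

    ≬Xₙ-mono : ∀ {U : Pred Carrier 0ℓ} {m n} → m ≤ n → U ≬ Xₙ m → U ≬ Xₙ n
    ≬Xₙ-mono m≤n (x , x∈U , x∈Xₘ) = x , x∈U , Xₙ-mono-≤ m≤n x∈Xₘ

    𝓤-local : ∀ {n α β U} → α ≡[ n ] β → U ≬ Xₙ n → U ∈ 𝓤 α → U ∈ 𝓤 β
    𝓤-local {n} α≡β U≬Xₙ U∈𝓤α = proj₁ (proj₁ (L1 n α≡β) (U∈𝓤α , U≬Xₙ))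

    -- Labelling members by vertices

    Labels : M → Pred Carrier 0ℓ → Pred ℕ 0ℓ
    Labels f U v = U ⊆ to f ⊢ St K v

    label : M → Pred Carrier 0ℓ → ℕ
    label f U = least (Labels f U)

    label-cong : ∀ f {U V} → U ≐ V → label f U ≡ label f V
    label-cong f (U⊆V , V⊆U) = least-cong ((λ V⊆St x∈V → V⊆St (V⊆U x∈V)) , (λ U⊆St x∈U → U⊆St (U⊆V x∈U)))

    Labels-cong : ∀ {f g} → Setoid._≈_ (Space.setoid Maps) f g → ∀ U → Labels f U ≐ Labels g U
    Labels-cong {f} {g} f≈g U =
      (λ {v} U⊆St {x} x∈U → St-resp v {to f x} {to g x} (f≈g x) (U⊆St x∈U)) ,
      (λ {v} U⊆St {x} x∈U → St-resp v {to g x} {to f x}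
        (Setoid.sym (Space.setoid ∣ K ∣ᵀ) {to f x} {to g x} (f≈g x)) (U⊆St x∈U))
      where
      St-resp : ∀ v → St K v Respects Space._≈_ ∣ K ∣ᵀ
      St-resp v {x} {y} = Space.open-resp ∣ K ∣ᵀ (St-open K v) {x} {y}

    -- The refinement condition of (E1) for the pulled-back stars, without a refinement map;
    -- `Labellable⇒⪯` and `⪯⇒Labellable` translate between the two.
    Labellable : M → ℕ → 𝒩* → Set₁
    Labellable f n α = ∀ {U} → U ∈ 𝓤 α → U ≬ Xₙ n → Satisfiable (Labels f U)

    Labellable-local : ∀ {f n α β} → α ≡[ n ] β → Labellable f n α → Labellable f n β
    Labellable-local α≡β labels U∈𝓤β U≬Xₙ =
      labels (𝓤-local (λ i<n → ≡.sym (α≡β i<n)) U≬Xₙ U∈𝓤β) U≬Xₙ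

    Labellable-cong : ∀ {f g} → Setoid._≈_ (Space.setoid Maps) f g →
                      ∀ {n α} → Labellable f n α → Labellable g n α
    Labellable-cong {f} {g} f≈g labels {U} U∈𝓤 U≬Xₙ =
      let v , v-labels = labels U∈𝓤 U≬Xₙ in v , proj₁ (Labels-cong {f} {g} f≈g U) v-labels

    pullback : M → Family Carrier
    pullback f W = ∃[ v ] W ≐ to f ⊢ St K v

    pullback-cover : ∀ f → OpenCover X (pullback f)
    pullback-cover f = record
      { isOpen = λ (v , W≐) → Open-resp-≐ X (≐-sym W≐) (continuous f (St-open K v))
      ; covers = λ x → let v , fx∈St = St-cover {K} (to f x)
                       in to f ⊢ St K v , (v , ≐-refl) , fx∈St
      }

    Labellable⇒⪯ : ∀ {f n α} → Labellable f n α → pullback f ↾ Xₙ n ⪯ 𝓤 α ↾ Xₙ n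
    Labellable⇒⪯ {f} labels =
      (λ (U , U∈𝓤 , x , x∈U , x∈Xₙ) →
        let v , U⊆St = labels U∈𝓤 (x , x∈U , x∈Xₙ)
        -- A point of `U` in `Xₙ n` also shows that the larger pulled-back star meets `Xₙ n`.
        in to f ⊢ St K v , (v , ≐-refl) , x , U⊆St x∈U , x∈Xₙ) ,
      (λ (U , U∈𝓤 , x , x∈U , x∈Xₙ) → proj₂ (labels U∈𝓤 (x , x∈U , x∈Xₙ)))

    ⪯⇒Labellable : ∀ {f n α} → pullback f ↾ Xₙ n ⪯ 𝓤 α ↾ Xₙ n → Labellable f n α
    ⪯⇒Labellable (r , U⊆rU) {U} U∈𝓤 U≬Xₙ =
      let _ , (v , W⊆St , _) , _ = r (U , U∈𝓤 , U≬Xₙ)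
      in v , λ x∈U → W⊆St (U⊆rU (U , U∈𝓤 , U≬Xₙ) x∈U)

    -- (E1) gives some `β` that extends the prefix and works one stage further. By (L1) only one
    -- more value of `β` matters, and it is coded by a single increment.
    Labellable-extend : ∀ {f} ks → Labellable f (length ks) (partialSums ks) →
      ∃[ k ] Labellable f (suc (length ks)) (partialSums (k ∷ ks))
    Labellable-extend {f} ks labels =
      let β , β≡ , 𝓦⪯ = E1 (length ks) (pullback-cover f) ℕₚ.≤-refl (Labellable⇒⪯ {f} labels)
          k , β≡′     = ∃partialSums {β} ks β≡
      in k , Labellable-local {f} {α = β} β≡′ (⪯⇒Labellable {f} 𝓦⪯)

    -- Greedy choice of the sequence

    -- Taking the least admissible increment makes the choice canonical, hence both extensional and
    -- measurable in `f`.
    increments : M → ℕ → List ℕ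
    increments f zero    = []
    increments f (suc n) =
      least (λ k → Labellable f (suc n) (partialSums (k ∷ increments f n))) ∷ increments f n

    length-increments : ∀ f n → length (increments f n) ≡ n
    length-increments f zero    = refl
    length-increments f (suc n) = cong suc (length-increments f n)

    -- The induction starts since `Xₙ 0` is empty; afterwards an admissible increment always exists,
    -- so `least` never falls back on its default 0.
    increments-labellable : ∀ f n → Labellable f n (partialSums (increments f n))
    increments-labellable f zero _ (x , _ , x∈X₀) = contradiction x∈X₀ (X₀-empty x)
    increments-labellable f (suc n) =
      least∈ (subst (λ m → ∃[ k ] Labellable f (suc m) (partialSums (k ∷ increments f n)))
        (length-increments f n)
        (Labellable-extend {f} (increments f n)
          (subst (λ m → Labellable f m (partialSums (increments f n)))
            (≡.sym (length-increments f n)) (increments-labellable f n))))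

    increments-cong : ∀ {f g} → Setoid._≈_ (Space.setoid Maps) f g → increments f ≗ increments g
    increments-cong {f} {g} f≈g zero    = refl
    increments-cong {f} {g} f≈g (suc n) rewrite increments-cong {f} {g} f≈g n =
      cong (_∷ increments g n) (least-cong
        ( Labellable-cong {f} {g} f≈g
        , Labellable-cong {g} {f} (Setoid.sym (Space.setoid Maps) {f} {g} f≈g)))

    sum-increments-mono : ∀ f {m n} → m ≤ n → sum (increments f m) ≤ sum (increments f n)
    sum-increments-mono f m≤n = go (ℕₚ.≤⇒≤′ m≤n)
      where
      go : ∀ {m n} → m ≤′ n → sum (increments f m) ≤ sum (increments f n)
      go ≤′-refl       = ℕₚ.≤-refl
      go (≤′-step m≤n) = ℕₚ.≤-trans (go m≤n) (ℕₚ.m≤n+m _ _)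

    limit : M → 𝒩*
    limit f = record
      -- The value at `i` is settled at stage `suc i`, so that stage `n` fixes exactly the first `n`
      -- values.
      { at   = λ i → sum (increments f (suc i))
      ; mono = λ i≤j → sum-increments-mono f (s≤s i≤j)
      }

    limit≡ : ∀ f n → limit f ≡[ n ] partialSums (increments f n)
    limit≡ f (suc n) {i} i<1+n with ℕₚ.m<1+n⇒m<n∨m≡n i<1+n
    ... | inj₁ i<n  = ≡.trans (limit≡ f n i<n) (≡.sym (partialSum-< _ (increments f n)
                        (subst (i <_) (≡.sym (length-increments f n)) i<n)))
    ... | inj₂ refl = ≡.sym (partialSum-≥ _ (increments f n) (ℕₚ.≤-reflexive (length-increments f n)))

    ≡limit : ∀ f n → partialSums (increments f n) ≡[ n ] limit f
    ≡limit f n i<n = ≡.sym (limit≡ f n i<n)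

    -- `U` meets some `Xₙ n`, and by (L1) it belongs to the cover of the prefix chosen at stage `n`,
    -- which is labellable there.
    label-labels : ∀ f {U} → U ∈ 𝓤 (limit f) → label f U ∈ Labels f U
    label-labels f U∈𝓤 =
      let n , U≬Xₙ = meets-Xₙ {limit f} U∈𝓤
      in least∈ (increments-labellable f n (𝓤-local (limit≡ f n) U≬Xₙ U∈𝓤) U≬Xₙ)

    -- The simplicial map

    assign : M → S 𝐔 → ℕ
    assign f (U , _) with em {P = U ∈ 𝓤 (limit f)}
    ... | yes _ = label f U
    ... | no _  = 0

    assign-∈ : ∀ f s → proj₁ s ∈ 𝓤 (limit f) → assign f s ≡ label f (proj₁ s)
    assign-∈ f (U , _) U∈𝓤 with em {P = U ∈ 𝓤 (limit f)}
    ... | yes _  = refl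
    ... | no U∉𝓤 = contradiction U∈𝓤 U∉𝓤

    assign-∉ : ∀ f s → proj₁ s ∉ 𝓤 (limit f) → assign f s ≡ 0
    assign-∉ f (U , _) U∉𝓤 with em {P = U ∈ 𝓤 (limit f)}
    ... | yes U∈𝓤 = contradiction U∈𝓤 U∉𝓤
    ... | no _    = refl

    -- One case split that serves equal sets, equal maps, and maps that merely share finitely many
    -- data.
    assign-cong : ∀ {f g} s t →
      (proj₁ s ∈ 𝓤 (limit f) → proj₁ t ∈ 𝓤 (limit g)) →
      (proj₁ t ∈ 𝓤 (limit g) → proj₁ s ∈ 𝓤 (limit f)) →
      (proj₁ s ∈ 𝓤 (limit f) → label f (proj₁ s) ≡ label g (proj₁ t)) →
      assign f s ≡ assign g t
    assign-cong {f} {g} s t to-t to-s labels≡ with em {P = proj₁ s ∈ 𝓤 (limit f)}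
    ... | yes s∈ = ≡.trans (labels≡ s∈) (≡.sym (assign-∈ g t (to-t s∈)))
    ... | no s∉  = ≡.sym (assign-∉ g t (s∉ ∘ to-s))

    assign∈St : ∀ f s → proj₁ s ∈ 𝓤 (limit f) → ∀ {x} → x ∈ proj₁ s → to f x ∈ St K (assign f s)
    assign∈St f s s∈ {x} x∈ = subst (λ v → to f x ∈ St K v) (≡.sym (assign-∈ f s s∈)) (label-labels f s∈ x∈)

    approximation : M → SAPair 𝐔 K
    approximation f = record
      { α          = limit f
      ; p          = record
        { to   = assign f
        ; cong = λ {s} {t} s≐t → assign-cong {f} {f} s t
            (𝓤-resp (limit f) s≐t) (𝓤-resp (limit f) (≐-sym s≐t)) (λ _ → label-cong f s≐t)
        }
      ; simplicial = simplicial
      ; vanishing  = assign-∉ f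
      }
      where
      open SimplicialComplex K using (face)

      simplicial : ∀ σ → σ ∈ Nerve (𝓤 (limit f)) →
                   SimplicialComplex.Simplex K (map (assign f ∘ member 𝐔 {limit f}) σ)
      simplicial []        (σ≢[] , _) = contradiction refl σ≢[]
      -- At a common point `x` of the members, `to f x` lies in the stars of all assigned vertices.
      -- These therefore belong to its support, which is a simplex.
      simplicial σ@(_ ∷ _) (_ , x , x∈) = face (Point.isSimplex (to f x)) (λ ()) λ v∈ →
        in-support σ x∈ v∈
        where
        in-support : ∀ σ → All (λ U → x ∈ proj₁ U) σ →
          ∀ {v} → v ∈ᴸ map (assign f ∘ member 𝐔 {limit f}) σ → v ∈ᴸ Point.support (to f x)
        in-support ((U , U∈𝓤) ∷ σ) (x∈U ∷ _) (here refl) =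
          Equivalence.from (Point.isSupport (to f x)) (assign∈St f (U , limit f , U∈𝓤) U∈𝓤 x∈U)
        in-support (_ ∷ σ) (_ ∷ x∈) (there v∈) = in-support σ x∈ v∈

    approximate : Func (Space.setoid Maps) (Space.setoid (SA 𝐔 K))
    approximate = record
      { to   = approximation
      ; cong = λ {f} {g} f≈g →
          let limit≗ = λ i → cong sum (increments-cong {f} {g} f≈g (suc i)) in
          limit≗ ,
          λ s → assign-cong {f} {g} s s (proj₁ (𝓤-cong limit≗)) (proj₂ (𝓤-cong limit≗))
                  (λ _ → least-cong (Labels-cong {f} {g} f≈g (proj₁ s)))
      }

    -- Dependence on finitely many data

    trace : ℕ → 𝒩* → List (Pred Carrier 0ℓ)
    trace n α = proj₁ (finite-↾ X (𝓤-resp α) (𝓤-locFin α) (Xₙ-compact n))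

    trace⊆ : ∀ n α → All (_∈ 𝓤 α ↾ Xₙ n) (trace n α)
    trace⊆ n α = proj₁ (proj₂ (finite-↾ X (𝓤-resp α) (𝓤-locFin α) (Xₙ-compact n)))

    trace⊇ : ∀ n α {U} → U ∈ 𝓤 α ↾ Xₙ n → Any (U ≐_) (trace n α)
    trace⊇ n α = proj₂ (proj₂ (finite-↾ X (𝓤-resp α) (𝓤-locFin α) (Xₙ-compact n)))

    -- Both label lists use the trace belonging to `g`. For fixed `g` this is therefore literally a
    -- `Fibre`, as defined in `open-preimage-measurable`.
    SameData : ℕ → M → M → Set
    SameData n f g = increments f n ≡ increments g n ×
      map (label f) (trace n (partialSums (increments g n))) ≡
      map (label g) (trace n (partialSums (increments g n)))

    map-≡⇒label≡ : ∀ {f g U} Us → map (label f) Us ≡ map (label g) Us →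
                   Any (U ≐_) Us → label f U ≡ label g U
    map-≡⇒label≡ {f} {g} {U} (V ∷ Vs) eq (here U≐V) = begin
      label f U ≡⟨ label-cong f U≐V ⟩
      label f V ≡⟨ proj₁ (∷-injective eq) ⟩
      label g V ≡⟨ label-cong g U≐V ⟨
      label g U ∎
      where open ≡.≡-Reasoning
    map-≡⇒label≡ {f} {g} (V ∷ Vs) eq (there U∈) = map-≡⇒label≡ {f} {g} Vs (proj₂ (∷-injective eq)) U∈

    limit-local : ∀ {f g n} → increments f n ≡ increments g n → limit f ≡[ n ] limit g
    limit-local {f} {g} {n} eq i<n =
      ≡.trans (limit≡ f n i<n) (≡.trans (cong (λ ks → partialSum ks _) eq) (≡limit g n i<n))

    -- By (L1) the shared prefix decides whether a set meeting `Xₙ n` belongs to the cover; if it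
    -- does, it has a representative in the trace, where the labels agree.
    assign-local : ∀ {f g n} → SameData n f g → ∀ s → proj₁ s ≬ Xₙ n → assign f s ≡ assign g s
    assign-local {f} {g} {n} (incr≡ , labels≡) s s≬Xₙ = assign-cong {f} {g} s s
      (𝓤-local (limit-local {f} {g} incr≡) s≬Xₙ)
      (𝓤-local (limit-local {g} {f} (≡.sym incr≡)) s≬Xₙ)
      (λ s∈ → map-≡⇒label≡ {f} {g} (trace n (partialSums (increments g n))) labels≡
        (trace⊇ n _
          (𝓤-local {α = limit g} (limit≡ g n) s≬Xₙ (𝓤-local (limit-local {f} {g} incr≡) s≬Xₙ s∈) , s≬Xₙ)))

    -- Stated for all large `n`, so that the finitely many constraints of a basic open set can be
    -- handled at a common stage.
    FixValue-local : ∀ {B} → B ∈ FixValue 𝐔 K → ∀ f → approximation f ∈ B →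
      ∃[ N ] ∀ n → N ≤ n → ∀ {g} → SameData n g f → approximation g ∈ B
    FixValue-local (fix-α i k) f f∈ =
      suc i , λ n i<n {g} (incr≡ , _) → ≡.trans (limit-local {g} {f} incr≡ i<n) f∈
    FixValue-local (fix-p s@(U , α , U∈𝓤) k) f f∈ =
      let N , U≬ = meets-Xₙ {α} U∈𝓤
      in N , λ n N≤n {g} same → ≡.trans (assign-local {g} {f} same s (≬Xₙ-mono N≤n U≬)) f∈

    open-local : ∀ {W} → Space.Open (SA 𝐔 K) W → ∀ f → approximation f ∈ W →
      ∃[ n ] ∀ {g} → SameData n g f → approximation g ∈ W
    open-local W-open f f∈W =
      let Bs , Bs∈ , f∈Bs , Bs⊆W = W-open f∈W
          N , local = all Bs Bs∈ f∈Bs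
      in N , λ same → Bs⊆W (local N ℕₚ.≤-refl same)
      where
      all : ∀ Bs → All (_∈ FixValue 𝐔 K) Bs → All (approximation f ∈_) Bs →
        ∃[ N ] ∀ n → N ≤ n → ∀ {g} → SameData n g f → All (approximation g ∈_) Bs
      all [] [] [] = 0 , λ _ _ _ → []
      all (B ∷ Bs) (B∈ ∷ Bs∈) (f∈B ∷ f∈Bs) =
        let M , local₁ = FixValue-local B∈ f f∈B
            N , local₂ = all Bs Bs∈ f∈Bs
        in M ℕ.⊔ N , λ n n≥ same → local₁ n (ℕₚ.m⊔n≤o⇒m≤o M N n≥) same
                                   ∷ local₂ n (ℕₚ.m⊔n≤o⇒n≤o M N n≥) same

    -- Measurability of the construction

    module _ {d} (metric : IsMetric X d) (induces : Induces X d) where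
      open Measurability Maps

      -- `U` is the union of the compact sets `Xₙ n ∩ inner U k`, and sending one of them into an
      -- open star is a subbasic condition of the compact-open topology.
      Labels-measurable : ∀ {U} → Open U → ∀ v → Measurable (λ f → v ∈ Labels f U)
      Labels-measurable {U} U-open v = Measurable-resp
        ( (λ f∈ {x} x∈U → let n , x∈Xₙ    = Xₙ-exhaust x
                              k , x∈inner = open⊆⋃inner X metric induces U-open x∈U
                          in f∈ n k (x∈Xₙ , x∈inner))
        , (λ U⊆St n k {_} (_ , x∈inner) → U⊆St (inner⊆ X metric induces x∈inner)) )
        (⋂-measurable λ n → ⋂-measurable λ k →
          open-measurable (compact-open-isOpen X ∣ K ∣ᵀ (compact-open
            (Compact-∩-closed X (Xₙ-compact n) (inner-closed X metric induces U k))
            (St-open K v))))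

      trace-open : ∀ n α → All Open (trace n α)
      trace-open n α = All.map (λ {U} (U∈𝓤 , _) → OpenCover.isOpen (𝓤-cover α) U∈𝓤)
                               (trace⊆ n α)

      -- The trace turns the quantifier over all members meeting `Xₙ n` into a finite conjunction.
      Labellable-measurable : ∀ n α → Measurable (λ f → Labellable f n α)
      Labellable-measurable n α = Measurable-resp
        {P = λ f → All (λ U → Satisfiable (Labels f U)) (trace n α)}
        {Q = λ f → Labellable f n α}
        ( (λ all U∈𝓤 U≬Xₙ →
            let (v , V⊆St) , (U⊆V , _) = All.lookupAny all (trace⊇ n α (U∈𝓤 , U≬Xₙ))
            in v , λ x∈U → V⊆St (U⊆V x∈U))
        , (λ labels → All.map (λ {U} (U∈𝓤 , U≬Xₙ) → labels {U} U∈𝓤 U≬Xₙ) (trace⊆ n α)) )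
        (All-measurable (All.map (λ U-open → ⋃-measurable (Labels-measurable U-open)) (trace-open n α)))

      -- Once the earlier increments are fixed to be `ks`, the next is the least element of a set
      -- that no longer refers to `increments`.
      increments-measurable : ∀ n ks → Measurable (λ f → increments f n ≡ ks)
      increments-measurable zero    ks       = const-measurable ([] ≡ ks)
      increments-measurable (suc n) []       = Measurable-resp ((λ ()) , (λ ())) (const-measurable ⊥)
      increments-measurable (suc n) (k ∷ ks) = Measurable-resp
        ((λ { (refl , eq) → cong (_∷ ks) eq }) , (λ { refl → refl , refl }))
        (∩-measurable (increments-measurable n ks)
          (least-measurable (λ k → Labellable-measurable (suc n) (partialSums (k ∷ ks))) k))

      labels-measurable : ∀ n α ls → Measurable (λ f → map (label f) (trace n α) ≡ ls)
      labels-measurable n α = map-measurable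
        (All.map (λ U-open → least-measurable (Labels-measurable U-open)) (trace-open n α))

      -- An open set is the union, over the countably many possible data, of
      -- the fibres of the data contained in it.
      open-preimage-measurable : ∀ {W} → Space.Open (SA 𝐔 K) W →
                                 Measurable (λ f → approximation f ∈ W)
      open-preimage-measurable {W} W-open = Measurable-resp
        {P = λ f → ∃[ n ] ∃[ ks ] ∃[ ls ] f ∈ Fibre n ks ls × Fibre n ks ls ⊆ approximation ⊢ W}
        ( (λ (_ , _ , _ , f∈ , fibre⊆) → fibre⊆ f∈)
        , (λ {f} f∈W → let n , local = open-local W-open f f∈W in
            n , increments f n , map (label f) (trace n (partialSums (increments f n))) ,
            (refl , refl) , λ {g} same → local {g} same) )
        (⋃-measurable λ n → ⋃-List-measurable λ ks → ⋃-List-measurable λ ls → ∩-measurable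
          (∩-measurable (increments-measurable n ks) (labels-measurable n (partialSums ks) ls))
          -- Whether a fibre lies inside the preimage does not depend on `f`; this factor keeps the
          -- fibre or discards it entirely.
          (const-measurable (Fibre n ks ls ⊆ approximation ⊢ W)))
        where
        Fibre : ℕ → List ℕ → List ℕ → Pred M 0ℓ
        Fibre n ks ls f = increments f n ≡ ks × map (label f) (trace n (partialSums ks)) ≡ ls

      -- Preimages commute with complements and countable unions, so induction on the Borel set
      -- reduces to open sets.
      approximate-borel : BorelMap Maps (SA 𝐔 K) approximate
      approximate-borel (open-set W-open)     = Measurable⇒Borel (open-preimage-measurable W-open)
      approximate-borel (complement B-borel)  = complement (approximate-borel B-borel)
      approximate-borel (⋃-ℕ B-borel)         = ⋃-ℕ (λ n → approximate-borel (B-borel n))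
      approximate-borel (resp-≐ (B⊆ , ⊆B) B-borel) = resp-≐ (B⊆ , ⊆B) (approximate-borel B-borel)

lemma5p5 : (∀ {ℓ} → ExcludedMiddle ℓ) →
    (X : Space 0ℓ 0ℓ 0ℓ) → LocallyCompact X → Polish X →
    (𝐔 : CoveringSystem X) (let open CoveringSystem 𝐔) →
    (∀ α {U} → U ∈ 𝓤 α → Satisfiable U) →
    (K : SimplicialComplex) → LocallyFiniteComplex K →
    Σ[ Φ ∈ Func (Space.setoid (Map X ∣ K ∣ᵀ)) (Space.setoid (SA 𝐔 K)) ]
    BorelMap (Map X ∣ K ∣ᵀ) (SA 𝐔 K) Φ ×
    (∀ f → let open SAPair (Func.to Φ f) in
    ∀ {U} (U∈𝓤α : U ∈ 𝓤 α) {x} → x ∈ U →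
    ContinuousMap.to f x ∈ St K p[ U , α , U∈𝓤α ])
lemma5p5 em X _ (_ , _ , metric , induces , _) 𝐔 nonempty K _ =
  approximate em X 𝐔 nonempty K ,
  approximate-borel em X 𝐔 nonempty K metric induces ,
  λ f {U} U∈𝓤α x∈U → assign∈St em X 𝐔 nonempty K f (U , _ , U∈𝓤α) U∈𝓤α x∈U
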